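{- Let $\mathcal{K}=(\mathcal{T},\mathcal{A})$ be a knowledge base and let $S$ be the set of atomic concepts and atomic roles occurring in $\mathcal{A}$ and $\mathcal{T}$. Then $\Xi(\mathcal{T})$, $\mathsf{R}_{S}(\Xi(\mathcal{T}))$ and $\mathcal{K}^{*}$ are equisatisfiable (that is, one of them has a model if and only if each of the others has a model).
   Context: Knowledge bases are in the description logic $\mathcal{SHI}$: roles are atomic roles and their inverses; concepts are built from atomic concepts by $\top,\bot,\neg,\sqcap,\sqcup,\exists R.C,\forall R.C$; a TBox $\mathcal T$ is a finite set of inclusions $C\sqsubseteq D$ (the RBox, consisting of role inclusions and transitivity axioms, is suppressed in the notation $\mathcal K=(\mathcal T,\mathcal A)$); an ABox $\mathcal A$ is a finite set of assertions $A(a)$, $R(a,b)$ with $A$ an atomic concept, $R$ an atomic role, $a,b$ individuals. Interpretations and satisfaction are standard. DL-clauses: an atom is of the form $B(s)$, $R(s,t)$, $\exists R.B(s)$ or $\exists R.\neg B(s)$, with $B$ an atomic concept and $s,t$ individuals or variables. A DL-clause is $V_1\lor\dots\lor V_n\leftarrow U_1\land\dots\land U_m$ ($n,m\ge 0$) with $V_i$ atoms and $U_j$ atoms of the form $B(s)$ or $R(s,t)$; empty head is $\bot$, empty body $\top$. It is read as a universally quantified implication from the body to the head. A clause is also written $\mathbf H\leftarrow\mathbf B$ with head and body as sets of atoms. $\Xi(\mathcal T)$ denotes the set of DL-clauses obtained from $\mathcal T$ by the standard (structural) transformation of Motik, Shearer and Horrocks; it satisfies: for every interpretation $\mathcal I$,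 $\mathcal I\models\mathcal K$ iff $\mathcal I\models\Xi(\mathcal T)$ and $\mathcal I\models\mathcal A$. Symbol extraction: $\sigma(B(s))=B$, $\sigma(R(s,t))=R$, $\sigma(\exists R.B(s))=\exists R.B$ ($B$ an atomic or negated atomic concept). For each atomic concept or role $X$, $NegX$ and $ABoxX$ are new predicate symbols of the same arity; $Neg(A(a))=NegA(a)$, $Neg(R(a,b))=NegR(a,b)$, $ABox(A(a))=ABoxA(a)$, $ABox(R(a,b))=ABoxR(a,b)$. Renaming: for a set $S$ of atomic concepts and atomic roles and $C=\mathbf H\leftarrow\mathbf B$, $\mathsf R_S(C)$ is the union of (1) $\{C\}$; (2) the single clause $\bigvee_{A\in\mathbf H,\sigma(A)\notin S}A\ \lor\ \bigvee_{B\in\mathbf B,\sigma(B)\in S}Neg(B)\ \leftarrow\ \bigwedge_{B\in\mathbf B,\sigma(B)\notin S}B\ \land\ \bigwedge_{A\in\mathbf H,\sigma(A)\in S}Neg(A)$; (3) all clauses $\bot\leftarrow R(x,y)\land NegR(x,y)$ for roles $R\in S$ such that some $A\in\mathbf H\cup\mathbf B$ has $\sigma(A)=R$ or some $A\in\mathbf H$ is of the form $\exists R.C(z)$ ($C$ an atomic or negated atomic concept); (4) all clauses $\bot\leftarrow D(x)\land NegD(x)$ for atomic concepts $D\in S$ such that some $A\in\mathbf H\cup\mathbf B$ has $\sigma(A)=D$ or some $A\in\mathbf H$ is of the form $\exists R.D(z)$. For a set $DL$ of DL-clauses, $\mathsf R_S(DL)=\bigcup_{C\in DL}\mathsf R_S(C)$.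 $\mathcal K^*$-transformation: with $S_{\mathcal A}$ the set of atomic concepts and atomic roles occurring in $\mathcal A$, $\mathcal K^*=\mathsf R_{S_{\mathcal A}}(\Xi(\mathcal T))\cup\{ABox(A)\leftarrow\top\mid A\in\mathcal A\}$. (The paper introduces $\mathcal K^*$ for knowledge bases with consistent $\mathcal T$, but the construction makes sense for any $\mathcal T$.) -}

module Defs where

open import Data.Bool using (Bool; true; false; if_then_else_; _∨_) renaming (_≟_ to _≟ᵇ_)
open import Data.Empty using (⊥)
open import Data.List using (List; []; _∷_; _++_; map; concatMap; filter)
open import Data.List.Membership.Propositional using (_∈_)
import Data.List.Membership.DecPropositional as DecMembership
open import Data.List.Relation.Unary.All using (All)
open import Data.List.Relation.Unary.Any using (Any; any?)
open import Data.Nat using (ℕ; suc)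
open import Data.Product using (Σ-syntax; _×_; _,_)
open import Data.Sum using (_⊎_)
open import Function using (_∘_)
open import Function.Bundles using (_⇔_)
open import Relation.Binary.Definitions using (DecidableEquality)
open import Relation.Binary.PropositionalEquality using (_≡_; refl; cong)
open import Relation.Nullary using (Dec; yes; no; ¬_; ¬?)
open import Relation.Nullary.Decidable using (map′; _×-dec_; _⊎-dec_)

record Signature : Set₁ where
  field
    Conc : Set
    Rol  : Set
    Ind  : Set

open Signature public

record DecSignature (𝒮 : Signature) : Set where
  field
    _≟ᶜ_ : DecidableEquality (Conc 𝒮)
    _≟ʳ_ : DecidableEquality (Rol 𝒮)

data Role (𝒮 : Signature) : Set where
  atomic  : Rol 𝒮 → Role 𝒮
  inverse : Rol 𝒮 → Role 𝒮

data Concept (𝒮 : Signature) : Set where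
  atom    : Conc 𝒮 → Concept 𝒮
  ⊤ᶜ ⊥ᶜ   : Concept 𝒮
  ¬ᶜ_     : Concept 𝒮 → Concept 𝒮
  _⊓_ _⊔_ : Concept 𝒮 → Concept 𝒮 → Concept 𝒮
  ∃ᶜ ∀ᶜ   : Role 𝒮 → Concept 𝒮 → Concept 𝒮

data ConceptInclusion (𝒮 : Signature) : Set where
  _⊑_ : Concept 𝒮 → Concept 𝒮 → ConceptInclusion 𝒮

data RoleAxiom (𝒮 : Signature) : Set where
  _⊑ʳ_  : Role 𝒮 → Role 𝒮 → RoleAxiom 𝒮
  trans : Role 𝒮 → RoleAxiom 𝒮

data Assertion (𝒮 : Signature) : Set where
  conc : Conc 𝒮 → Ind 𝒮 → Assertion 𝒮
  role : Rol 𝒮 → Ind 𝒮 → Ind 𝒮 → Assertion 𝒮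

-- Finite sets are represented by lists.  The RBox, often suppressed in
-- the notation (𝒯 , 𝒜), is part of 𝒯.

record Terminology (𝒮 : Signature) : Set where
  field
    tbox : List (ConceptInclusion 𝒮)
    rbox : List (RoleAxiom 𝒮)

record KB (𝒮 : Signature) : Set where
  field
    𝒯 : Terminology 𝒮
    𝒜 : List (Assertion 𝒮)

open Terminology public
open KB public

record SymbolSet (𝒮 : Signature) : Set where
  constructor ⟨_,_⟩
  field
    concepts : List (Conc 𝒮)
    roles    : List (Rol 𝒮)

open SymbolSet public

∅ : ∀ {𝒮} → SymbolSet 𝒮
∅ = ⟨ [] , [] ⟩

_∪_ : ∀ {𝒮} → SymbolSet 𝒮 → SymbolSet 𝒮 → SymbolSet 𝒮
⟨ cs , rs ⟩ ∪ ⟨ cs′ , rs′ ⟩ = ⟨ cs ++ cs′ , rs ++ rs′ ⟩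

module _ {𝒮 : Signature} where

  ⋃ : {X : Set} → (X → SymbolSet 𝒮) → List X → SymbolSet 𝒮
  ⋃ f []       = ∅
  ⋃ f (x ∷ xs) = f x ∪ ⋃ f xs

  symRole : Role 𝒮 → SymbolSet 𝒮
  symRole (atomic R)  = ⟨ [] , R ∷ [] ⟩
  symRole (inverse R) = ⟨ [] , R ∷ [] ⟩

  symConcept : Concept 𝒮 → SymbolSet 𝒮
  symConcept (atom A) = ⟨ A ∷ [] , [] ⟩
  symConcept ⊤ᶜ       = ∅
  symConcept ⊥ᶜ       = ∅
  symConcept (¬ᶜ C)   = symConcept C
  symConcept (C ⊓ D)  = symConcept C ∪ symConcept D
  symConcept (C ⊔ D)  = symConcept C ∪ symConcept D
  symConcept (∃ᶜ R C) = symRole R ∪ symConcept C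
  symConcept (∀ᶜ R C) = symRole R ∪ symConcept C

  symInclusion : ConceptInclusion 𝒮 → SymbolSet 𝒮
  symInclusion (C ⊑ D) = symConcept C ∪ symConcept D

  symRoleAxiom : RoleAxiom 𝒮 → SymbolSet 𝒮
  symRoleAxiom (R ⊑ʳ T)  = symRole R ∪ symRole T
  symRoleAxiom (trans R) = symRole R

  symAssertion : Assertion 𝒮 → SymbolSet 𝒮
  symAssertion (conc A a)   = ⟨ A ∷ [] , [] ⟩
  symAssertion (role R a b) = ⟨ [] , R ∷ [] ⟩

  symTerminology : Terminology 𝒮 → SymbolSet 𝒮
  symTerminology t = ⋃ symInclusion (tbox t) ∪ ⋃ symRoleAxiom (rbox t)

  symABox : List (Assertion 𝒮) → SymbolSet 𝒮
  symABox = ⋃ symAssertion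

data Literal (𝒮 : Signature) : Set where
  pos neg : Conc 𝒮 → Literal 𝒮

data Term (𝒮 : Signature) : Set where
  ind : Ind 𝒮 → Term 𝒮
  var : ℕ → Term 𝒮

data Atom (𝒮 : Signature) : Set where
  conc : Conc 𝒮 → Term 𝒮 → Atom 𝒮
  role : Rol 𝒮 → Term 𝒮 → Term 𝒮 → Atom 𝒮

-- Atoms ∃R.B(s) and ∃R.¬B(s) are only allowed in heads.

data HeadAtom (𝒮 : Signature) : Set where
  plain : Atom 𝒮 → HeadAtom 𝒮
  some  : Role 𝒮 → Literal 𝒮 → Term 𝒮 → HeadAtom 𝒮

record DLClause (𝒮 : Signature) : Set where
  constructor _⟵_
  field
    head : List (HeadAtom 𝒮)
    body : List (Atom 𝒮)

open DLClause public

infix 4 _⟵_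

record Interpretation (𝒮 : Signature) : Set₁ where
  field
    Δ     : Set
    point : Δ
    concᴵ : Conc 𝒮 → Δ → Set
    roleᴵ : Rol 𝒮 → Δ → Δ → Set
    indᴵ  : Ind 𝒮 → Δ

module Semantics {𝒮 : Signature} (ℐ : Interpretation 𝒮) where
  open Interpretation ℐ

  ⟦_⟧ʳ : Role 𝒮 → Δ → Δ → Set
  ⟦ atomic R ⟧ʳ  d e = roleᴵ R d e
  ⟦ inverse R ⟧ʳ d e = roleᴵ R e d

  ⟦_⟧ˡ : Literal 𝒮 → Δ → Set
  ⟦ pos B ⟧ˡ d = concᴵ B d
  ⟦ neg B ⟧ˡ d = ¬ concᴵ B d

  module _ (v : ℕ → Δ) where

    ⟦_⟧ᵗ : Term 𝒮 → Δ
    ⟦ ind a ⟧ᵗ = indᴵ a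
    ⟦ var n ⟧ᵗ = v n

    Holds : Atom 𝒮 → Set
    Holds (conc B s)   = concᴵ B ⟦ s ⟧ᵗ
    Holds (role R s t) = roleᴵ R ⟦ s ⟧ᵗ ⟦ t ⟧ᵗ

    HoldsHead : HeadAtom 𝒮 → Set
    HoldsHead (plain A)    = Holds A
    HoldsHead (some R L s) = Σ[ e ∈ Δ ] (⟦ R ⟧ʳ ⟦ s ⟧ᵗ e × ⟦ L ⟧ˡ e)

_⊨_ : ∀ {𝒮} → Interpretation 𝒮 → DLClause 𝒮 → Set
ℐ ⊨ C = ∀ v → All (Holds v) (body C) → Any (HoldsHead v) (head C)
  where open Semantics ℐ

Satisfiable : ∀ {𝒮} → List (DLClause 𝒮) → Set₁
Satisfiable {𝒮} DL = Σ[ ℐ ∈ Interpretation 𝒮 ] All (ℐ ⊨_) DL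

-- Equisatisfiable sets may be formulated over different signatures.

Equisatisfiable : ∀ {𝒮 𝒮′} → List (DLClause 𝒮) → List (DLClause 𝒮′) → Set₁
Equisatisfiable DL DL′ = Satisfiable DL ⇔ Satisfiable DL′

data Connective : Set where
  and or : Connective

data Quantifier : Set where
  exists all : Quantifier

data NNF (𝒮 : Signature) : Set where
  lit   : Literal 𝒮 → NNF 𝒮
  const : Bool → NNF 𝒮
  bin   : Connective → NNF 𝒮 → NNF 𝒮 → NNF 𝒮
  quant : Quantifier → Role 𝒮 → NNF 𝒮 → NNF 𝒮

module _ {𝒮 : Signature} where

  nnf  : Concept 𝒮 → NNF 𝒮
  nnf¬ : Concept 𝒮 → NNF 𝒮

  nnf (atom A) = lit (pos A)
  nnf ⊤ᶜ       = const true
  nnf ⊥ᶜ       = const false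
  nnf (¬ᶜ C)   = nnf¬ C
  nnf (C ⊓ D)  = bin and (nnf C) (nnf D)
  nnf (C ⊔ D)  = bin or (nnf C) (nnf D)
  nnf (∃ᶜ R C) = quant exists R (nnf C)
  nnf (∀ᶜ R C) = quant all R (nnf C)

  nnf¬ (atom A) = lit (neg A)
  nnf¬ ⊤ᶜ       = const false
  nnf¬ ⊥ᶜ       = const true
  nnf¬ (¬ᶜ C)   = nnf C
  nnf¬ (C ⊓ D)  = bin or (nnf¬ C) (nnf¬ D)
  nnf¬ (C ⊔ D)  = bin and (nnf¬ C) (nnf¬ D)
  nnf¬ (∃ᶜ R C) = quant all R (nnf¬ C)
  nnf¬ (∀ᶜ R C) = quant exists R (nnf¬ C)

-- Q C is the fresh atomic concept that the structural transformation of
-- Motik, Shearer and Horrocks associates with the concept C.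

data Named (𝒮 : Signature) : Set where
  original : Conc 𝒮 → Named 𝒮
  Q        : NNF 𝒮 → Named 𝒮

complement : ∀ {𝒮} → Literal 𝒮 → Literal 𝒮
complement (pos B) = neg B
complement (neg B) = pos B

Clausal : Signature → Signature
Clausal 𝒮 = record { Conc = Named 𝒮 ; Rol = Rol 𝒮 ; Ind = Ind 𝒮 }

module _ {𝒮 : Signature} where

  role↑ : Role 𝒮 → Role (Clausal 𝒮)
  role↑ (atomic R)  = atomic R
  role↑ (inverse R) = inverse R

  literal↑ : Literal 𝒮 → Literal (Clausal 𝒮)
  literal↑ (pos B) = pos (original B)
  literal↑ (neg B) = neg (original B)

  symbols↑ : SymbolSet 𝒮 → SymbolSet (Clausal 𝒮)
  symbols↑ ⟨ cs , rs ⟩ = ⟨ map original cs , rs ⟩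

  -- The function pos of Motik, Shearer and Horrocks, chosen so that Horn
  -- inputs yield Horn clauses.

  positive : NNF 𝒮 → Bool
  positive (lit (pos _))      = true
  positive (lit (neg _))      = false
  positive (const _)          = false
  positive (bin _ C D)        = positive C ∨ positive D
  positive (quant exists _ C) = true
  positive (quant all _ C)    = positive C

  α : NNF 𝒮 → Literal (Clausal 𝒮)
  α C = if positive C then pos (Q C) else neg (Q C)

  name : NNF 𝒮 → Literal (Clausal 𝒮)
  name (lit B) = literal↑ B
  name C       = α C

-- A normalised axiom ⊤ ⊑ D₁ ⊔ … ⊔ Dₙ is given by the list of its
-- disjuncts, each of the form B, ∃R.B or ∀R.B with B a literal.

data Disjunct (𝒮 : Signature) : Set where
  lit   : Literal 𝒮 → Disjunct 𝒮
  quant : Quantifier → Role 𝒮 → Literal 𝒮 → Disjunct 𝒮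

module _ {𝒮 : Signature} where

  -- Is ⊤ among the top-level disjuncts?
  trivial : NNF 𝒮 → Bool
  trivial (const b)    = b
  trivial (bin or C D) = trivial C ∨ trivial D
  trivial _            = false

  disjuncts : NNF 𝒮 → List (Disjunct (Clausal 𝒮))
  disjuncts (lit B)           = lit (literal↑ B) ∷ []
  disjuncts (const _)         = []
  disjuncts C@(bin and _ _)   = lit (α C) ∷ []
  disjuncts (bin or C D)      = disjuncts C ++ disjuncts D
  disjuncts (quant q R C)     = quant q (role↑ R) (name C) ∷ []

  -- ⊤ ⊑ D₁ ⊔ … ⊔ Dₙ ⊔ C, without the definitions of the fresh concepts
  -- used for C; an axiom with a disjunct ⊤ is dropped.
  axiom : List (Disjunct (Clausal 𝒮)) → NNF 𝒮 → List (List (Disjunct (Clausal 𝒮)))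
  axiom Ds C = if trivial C then [] else (Ds ++ disjuncts C) ∷ []

  definitions : NNF 𝒮 → List (List (Disjunct (Clausal 𝒮)))
  definitions (lit _)       = []
  definitions (const _)     = []
  definitions E@(bin and C D) =
    axiom (¬E ∷ []) C ++ definitions C ++ axiom (¬E ∷ []) D ++ definitions D
    where ¬E = lit (complement (α E))
  definitions (bin or C D)  = definitions C ++ definitions D
  definitions (quant _ _ (lit _)) = []
  definitions (quant _ _ C) = axiom (lit (complement (α C)) ∷ []) C ++ definitions C

  normalise : ConceptInclusion 𝒮 → List (List (Disjunct (Clausal 𝒮)))
  normalise (C ⊑ D) = axiom [] E ++ definitions E
    where E = bin or (nnf¬ C) (nnf D)

module _ {𝒮 : Signature} where

  ar : Role 𝒮 → Term 𝒮 → Term 𝒮 → Atom 𝒮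
  ar (atomic R)  s t = role R s t
  ar (inverse R) s t = role R t s

  x y z : Term 𝒮
  x = var 0
  y = var 1
  z = var 2

  -- clauseFrom k introduces the variables k + 1, k + 2, … for the
  -- universally quantified disjuncts.
  clauseFrom : ℕ → List (Disjunct 𝒮) → DLClause 𝒮
  clauseFrom k []       = [] ⟵ []
  clauseFrom k (D ∷ Ds) = add D (clauseFrom (suc k) Ds)
    where
    yₖ : Term 𝒮
    yₖ = var (suc k)

    add : Disjunct 𝒮 → DLClause 𝒮 → DLClause 𝒮
    add (lit (pos B))           (H ⟵ U) = plain (conc B x) ∷ H ⟵ U
    add (lit (neg B))           (H ⟵ U) = H ⟵ conc B x ∷ U
    add (quant exists R L)      (H ⟵ U) = some R L x ∷ H ⟵ U
    add (quant all R (pos B))   (H ⟵ U) = plain (conc B yₖ) ∷ H ⟵ ar R x yₖ ∷ U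
    add (quant all R (neg B))   (H ⟵ U) = H ⟵ ar R x yₖ ∷ conc B yₖ ∷ U

clauseOf : ∀ {𝒮} → List (Disjunct 𝒮) → DLClause 𝒮
clauseOf = clauseFrom 0

-- Transitivity is itself a DL-clause, hence it is not encoded away; every
-- model of Ξ t then interprets transitive roles as transitive relations.

roleClause : ∀ {𝒮} → RoleAxiom 𝒮 → DLClause (Clausal 𝒮)
roleClause (R ⊑ʳ T)  = plain (ar (role↑ T) x y) ∷ [] ⟵ ar (role↑ R) x y ∷ []
roleClause (trans R) =
  plain (ar (role↑ R) x z) ∷ [] ⟵ ar (role↑ R) x y ∷ ar (role↑ R) y z ∷ []

Ξ : ∀ {𝒮} → Terminology 𝒮 → List (DLClause (Clausal 𝒮))
Ξ t = map clauseOf (concatMap normalise (tbox t)) ++ map roleClause (rbox t)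

module _ {𝒮 : Signature} (dec : DecSignature 𝒮) where
  open DecSignature dec

  _≟ˡ_ : DecidableEquality (Literal 𝒮)
  pos A ≟ˡ pos B = map′ (cong pos) (λ { refl → refl }) (A ≟ᶜ B)
  pos _ ≟ˡ neg _ = no λ ()
  neg _ ≟ˡ pos _ = no λ ()
  neg A ≟ˡ neg B = map′ (cong neg) (λ { refl → refl }) (A ≟ᶜ B)

  _≟ᴿ_ : DecidableEquality (Role 𝒮)
  atomic R  ≟ᴿ atomic T  = map′ (cong atomic) (λ { refl → refl }) (R ≟ʳ T)
  atomic _  ≟ᴿ inverse _ = no λ ()
  inverse _ ≟ᴿ atomic _  = no λ ()
  inverse R ≟ᴿ inverse T = map′ (cong inverse) (λ { refl → refl }) (R ≟ʳ T)

  _≟ᵒ_ : DecidableEquality Connective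
  and ≟ᵒ and = yes refl
  and ≟ᵒ or  = no λ ()
  or  ≟ᵒ and = no λ ()
  or  ≟ᵒ or  = yes refl

  _≟q_ : DecidableEquality Quantifier
  exists ≟q exists = yes refl
  exists ≟q all    = no λ ()
  all    ≟q exists = no λ ()
  all    ≟q all    = yes refl

  _≟ⁿ_ : DecidableEquality (NNF 𝒮)
  lit L       ≟ⁿ lit M         = map′ (cong lit) (λ { refl → refl }) (L ≟ˡ M)
  lit _       ≟ⁿ const _       = no λ ()
  lit _       ≟ⁿ bin _ _ _     = no λ ()
  lit _       ≟ⁿ quant _ _ _   = no λ ()
  const _     ≟ⁿ lit _         = no λ ()
  const a     ≟ⁿ const b       = map′ (cong const) (λ { refl → refl }) (a ≟ᵇ b)
  const _     ≟ⁿ bin _ _ _     = no λ ()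
  const _     ≟ⁿ quant _ _ _   = no λ ()
  bin _ _ _   ≟ⁿ lit _         = no λ ()
  bin _ _ _   ≟ⁿ const _       = no λ ()
  bin o C D   ≟ⁿ bin p E F     =
    map′ (λ { (refl , refl , refl) → refl }) (λ { refl → refl , refl , refl })
         (o ≟ᵒ p ×-dec C ≟ⁿ E ×-dec D ≟ⁿ F)
  bin _ _ _   ≟ⁿ quant _ _ _   = no λ ()
  quant _ _ _ ≟ⁿ lit _         = no λ ()
  quant _ _ _ ≟ⁿ const _       = no λ ()
  quant _ _ _ ≟ⁿ bin _ _ _     = no λ ()
  quant q R C ≟ⁿ quant r T D   =
    map′ (λ { (refl , refl , refl) → refl }) (λ { refl → refl , refl , refl })
         (q ≟q r ×-dec R ≟ᴿ T ×-dec C ≟ⁿ D)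

  _≟ⁿᵃ_ : DecidableEquality (Named 𝒮)
  original A ≟ⁿᵃ original B = map′ (cong original) (λ { refl → refl }) (A ≟ᶜ B)
  original _ ≟ⁿᵃ Q _        = no λ ()
  Q _        ≟ⁿᵃ original _ = no λ ()
  Q C        ≟ⁿᵃ Q D        = map′ (cong Q) (λ { refl → refl }) (C ≟ⁿ D)

  decClausal : DecSignature (Clausal 𝒮)
  decClausal = record { _≟ᶜ_ = _≟ⁿᵃ_ ; _≟ʳ_ = _≟ʳ_ }

data Symbol (𝒮 : Signature) : Set where
  conc : Conc 𝒮 → Symbol 𝒮
  role : Rol 𝒮 → Symbol 𝒮
  some : Role 𝒮 → Literal 𝒮 → Symbol 𝒮

module _ {𝒮 : Signature} where

  σ : Atom 𝒮 → Symbol 𝒮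
  σ (conc B s)   = conc B
  σ (role R s t) = role R

  σᴴ : HeadAtom 𝒮 → Symbol 𝒮
  σᴴ (plain A)    = σ A
  σᴴ (some R L s) = some R L

  _∈ˢ_ : Symbol 𝒮 → SymbolSet 𝒮 → Set
  conc B   ∈ˢ S = B ∈ concepts S
  role R   ∈ˢ S = R ∈ roles S
  some R L ∈ˢ S = ⊥

data Variant (X : Set) : Set where
  old Neg ABox : X → Variant X

Extended : Signature → Signature
Extended 𝒮 = record { Conc = Variant (Conc 𝒮) ; Rol = Variant (Rol 𝒮) ; Ind = Ind 𝒮 }

module _ {𝒮 : Signature} where

  term⁺ : Term 𝒮 → Term (Extended 𝒮)
  term⁺ (ind a) = ind a
  term⁺ (var n) = var n

  role⁺ : Role 𝒮 → Role (Extended 𝒮)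
  role⁺ (atomic R)  = atomic (old R)
  role⁺ (inverse R) = inverse (old R)

  literal⁺ : Literal 𝒮 → Literal (Extended 𝒮)
  literal⁺ (pos B) = pos (old B)
  literal⁺ (neg B) = neg (old B)

  rename : (∀ {X} → X → Variant X) → Atom 𝒮 → Atom (Extended 𝒮)
  rename f (conc B s)   = conc (f B) (term⁺ s)
  rename f (role R s t) = role (f R) (term⁺ s) (term⁺ t)

  oldᵃ negᵃ : Atom 𝒮 → Atom (Extended 𝒮)
  oldᵃ = rename old
  negᵃ = rename Neg

  oldᴴ : HeadAtom 𝒮 → HeadAtom (Extended 𝒮)
  oldᴴ (plain A)    = plain (oldᵃ A)
  oldᴴ (some R L s) = some (role⁺ R) (literal⁺ L) (term⁺ s)

  oldClause : DLClause 𝒮 → DLClause (Extended 𝒮)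
  oldClause (H ⟵ B) = map oldᴴ H ⟵ map oldᵃ B

  plainAtoms : List (HeadAtom 𝒮) → List (Atom 𝒮)
  plainAtoms []               = []
  plainAtoms (plain A ∷ H)    = A ∷ plainAtoms H
  plainAtoms (some _ _ _ ∷ H) = plainAtoms H

  Occurs : Symbol 𝒮 → DLClause 𝒮 → Set
  Occurs X (H ⟵ B) = Any (λ A → σᴴ A ≡ X) H ⊎ Any (λ A → σ A ≡ X) B

  -- Both notions are literal: ∃R⁻.C(s) does not count for R, and
  -- ∃R.¬D(s) does not count for D.

  data RestrictsRole (R : Rol 𝒮) : HeadAtom 𝒮 → Set where
    restricts : ∀ {L s} → RestrictsRole R (some (atomic R) L s)

  data HasFiller (D : Conc 𝒮) : HeadAtom 𝒮 → Set where
    filler : ∀ {R s} → HasFiller D (some R (pos D) s)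

  RoleRelevant : DLClause 𝒮 → Rol 𝒮 → Set
  RoleRelevant C R = Occurs (role R) C ⊎ Any (RestrictsRole R) (head C)

  ConceptRelevant : DLClause 𝒮 → Conc 𝒮 → Set
  ConceptRelevant C D = Occurs (conc D) C ⊎ Any (HasFiller D) (head C)

  roleClash : Rol 𝒮 → DLClause (Extended 𝒮)
  roleClash R = [] ⟵ role (old R) x y ∷ role (Neg R) x y ∷ []

  conceptClash : Conc 𝒮 → DLClause (Extended 𝒮)
  conceptClash D = [] ⟵ conc (old D) x ∷ conc (Neg D) x ∷ []

module _ {𝒮 : Signature} (dec : DecSignature 𝒮) where
  open DecSignature dec
  open DecMembership _≟ᶜ_ using () renaming (_∈?_ to _∈ᶜ?_)
  open DecMembership _≟ʳ_ using () renaming (_∈?_ to _∈ʳ?_)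

  _∈ˢ?_ : (X : Symbol 𝒮) (S : SymbolSet 𝒮) → Dec (X ∈ˢ S)
  conc B   ∈ˢ? S = B ∈ᶜ? concepts S
  role R   ∈ˢ? S = R ∈ʳ? roles S
  some _ _ ∈ˢ? S = no λ ()

  _≡conc?_ : (X : Symbol 𝒮) (D : Conc 𝒮) → Dec (X ≡ conc D)
  conc B   ≡conc? D = map′ (cong conc) (λ { refl → refl }) (B ≟ᶜ D)
  role _   ≡conc? D = no λ ()
  some _ _ ≡conc? D = no λ ()

  _≡role?_ : (X : Symbol 𝒮) (R : Rol 𝒮) → Dec (X ≡ role R)
  conc _   ≡role? R = no λ ()
  role T   ≡role? R = map′ (cong role) (λ { refl → refl }) (T ≟ʳ R)
  some _ _ ≡role? R = no λ ()

  restrictsRole? : ∀ R (A : HeadAtom 𝒮) → Dec (RestrictsRole R A)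
  restrictsRole? R (plain _)              = no λ ()
  restrictsRole? R (some (atomic T) _ _)  =
    map′ (λ { refl → restricts }) (λ { restricts → refl }) (T ≟ʳ R)
  restrictsRole? R (some (inverse _) _ _) = no λ ()

  hasFiller? : ∀ D (A : HeadAtom 𝒮) → Dec (HasFiller D A)
  hasFiller? D (plain _)          = no λ ()
  hasFiller? D (some _ (pos B) _) =
    map′ (λ { refl → filler }) (λ { filler → refl }) (B ≟ᶜ D)
  hasFiller? D (some _ (neg _) _) = no λ ()

  roleRelevant? : ∀ C R → Dec (RoleRelevant {𝒮} C R)
  roleRelevant? (H ⟵ B) R =
    (any? (λ A → σᴴ A ≡role? R) H ⊎-dec any? (λ A → σ A ≡role? R) B)
    ⊎-dec any? (restrictsRole? R) H

  conceptRelevant? : ∀ C D → Dec (ConceptRelevant {𝒮} C D)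
  conceptRelevant? (H ⟵ B) D =
    (any? (λ A → σᴴ A ≡conc? D) H ⊎-dec any? (λ A → σ A ≡conc? D) B)
    ⊎-dec any? (hasFiller? D) H

  module _ (S : SymbolSet 𝒮) where

    -- Since X ∈ˢ S fails for X = σ(∃R.L(s)), the atoms of H with symbol in
    -- S are among the plain ones.
    contrapose : DLClause 𝒮 → DLClause (Extended 𝒮)
    contrapose (H ⟵ B) =
      map oldᴴ (filter (λ A → ¬? (σᴴ A ∈ˢ? S)) H)
        ++ map (plain ∘ negᵃ) (filter (λ A → σ A ∈ˢ? S) B)
      ⟵
      map oldᵃ (filter (λ A → ¬? (σ A ∈ˢ? S)) B)
        ++ map negᵃ (filter (λ A → σ A ∈ˢ? S) (plainAtoms H))

    renameClause : DLClause 𝒮 → List (DLClause (Extended 𝒮))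
    renameClause C =
      oldClause C ∷ contrapose C
        ∷ map roleClash (filter (roleRelevant? C) (roles S))
        ++ map conceptClash (filter (conceptRelevant? C) (concepts S))

    𝖱 : List (DLClause 𝒮) → List (DLClause (Extended 𝒮))
    𝖱 = concatMap renameClause

module _ {𝒮 : Signature} where

  assertionAtom : Assertion 𝒮 → Atom (Clausal 𝒮)
  assertionAtom (conc A a)   = conc (original A) (ind a)
  assertionAtom (role R a b) = role R (ind a) (ind b)

  aboxFact : Assertion 𝒮 → DLClause (Extended (Clausal 𝒮))
  aboxFact A = plain (rename ABox (assertionAtom A)) ∷ [] ⟵ []

  module _ (dec : DecSignature 𝒮) where

    Renamed : SymbolSet 𝒮 → Terminology 𝒮 → List (DLClause (Extended (Clausal 𝒮)))
    Renamed S t = 𝖱 (decClausal dec) (symbols↑ S) (Ξ t)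

    𝖪* : KB 𝒮 → List (DLClause (Extended (Clausal 𝒮)))
    𝖪* 𝒦 = Renamed (symABox (𝒜 𝒦)) (𝒯 𝒦) ++ map aboxFact (𝒜 𝒦)

{-# OPTIONS --safe #-}
-- Every set DL of DL-clauses is equisatisfiable with 𝖱 DL, even after adding
-- ABox facts.  The old symbols of a model of 𝖱 DL give a model of DL, because
-- 𝖱 keeps each clause.  Conversely, expand a model of DL by reading NegX as the
-- complement of X and ABoxX as everywhere true; the second clause of the
-- renaming is then classically equivalent to the original one.
module Submission where

open import Axiom.ExcludedMiddle using (ExcludedMiddle)
open import Data.List using (List; []; _∷_; map; filter)
open import Data.List.Membership.Propositional using (_∈_; find; lose)
open import Data.List.Membership.Propositional.Properties
  using (∈-map⁺; ∈-filter⁺)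
open import Data.List.Relation.Unary.All as All using (All; []; _∷_)
import Data.List.Relation.Unary.All.Properties as Allₚ
open import Data.List.Relation.Unary.Any as Any using (Any; here; there)
import Data.List.Relation.Unary.Any.Properties as Anyₚ
open import Data.Nat using (ℕ)
open import Data.Product using (_×_; _,_)
open import Data.Unit using (⊤; tt)
open import Function using (id; _∘_)
open import Function.Bundles using (_⇔_; mk⇔; Equivalence)
import Function.Properties.Equivalence as ⇔
open import Level using (0ℓ)
open import Relation.Binary.PropositionalEquality
  using (_≡_; refl; sym; cong; cong₂)
open import Relation.Nullary using (¬_; ¬?; yes; no; contradiction)
open import Relation.Nullary.Decidable using (decidable-stable)
open import Defs

open Interpretation
open Semantics

coe : {A B : Set} → A ≡ B → A → B
coe refl = id

module _ {𝒮 : Signature} where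

  reduct : Interpretation (Extended 𝒮) → Interpretation 𝒮
  reduct 𝒥 = record
    { Δ     = Δ 𝒥
    ; point = point 𝒥
    ; concᴵ = concᴵ 𝒥 ∘ old
    ; roleᴵ = roleᴵ 𝒥 ∘ old
    ; indᴵ  = indᴵ 𝒥
    }

  expand : Interpretation 𝒮 → Interpretation (Extended 𝒮)
  expand ℐ = record
    { Δ     = Δ ℐ
    ; point = point ℐ
    ; concᴵ = λ where
        (old B)  d → concᴵ ℐ B d
        (Neg B)  d → ¬ concᴵ ℐ B d
        (ABox B) d → ⊤
    ; roleᴵ = λ where
        (old R)  d e → roleᴵ ℐ R d e
        (Neg R)  d e → ¬ roleᴵ ℐ R d e
        (ABox R) d e → ⊤
    ; indᴵ  = indᴵ ℐ
    }

  module _ (𝒥 : Interpretation (Extended 𝒮)) (v : ℕ → Δ 𝒥) where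

    -- The two sides agree by computation only once `s` is a constructor. Hence atoms are compared
    -- by equality of types and transported with `coe`.
    term⁺-reduct : ∀ s → ⟦_⟧ᵗ 𝒥 v (term⁺ s) ≡ ⟦_⟧ᵗ (reduct 𝒥) v s
    term⁺-reduct (ind a) = refl
    term⁺-reduct (var n) = refl

    -- Equating the unapplied relations allows rewriting under the witness `e` bound in `HoldsHead`.
    role⁺-reduct : ∀ R → ⟦_⟧ʳ 𝒥 (role⁺ R) ≡ ⟦_⟧ʳ (reduct 𝒥) R
    role⁺-reduct (atomic R)  = refl
    role⁺-reduct (inverse R) = refl

    literal⁺-reduct : ∀ L → ⟦_⟧ˡ 𝒥 (literal⁺ L) ≡ ⟦_⟧ˡ (reduct 𝒥) L
    literal⁺-reduct (pos B) = refl
    literal⁺-reduct (neg B) = refl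

    Holds-old : ∀ A → Holds 𝒥 v (oldᵃ A) ≡ Holds (reduct 𝒥) v A
    Holds-old (conc B s)   = cong (concᴵ 𝒥 (old B)) (term⁺-reduct s)
    Holds-old (role R s t) =
      cong₂ (roleᴵ 𝒥 (old R)) (term⁺-reduct s) (term⁺-reduct t)

    HoldsHead-old : ∀ A → HoldsHead 𝒥 v (oldᴴ A) ≡ HoldsHead (reduct 𝒥) v A
    HoldsHead-old (plain A) = Holds-old A
    HoldsHead-old (some R L s)
      rewrite term⁺-reduct s | role⁺-reduct R | literal⁺-reduct L = refl

  -- `𝒥` and `reduct 𝒥` share their domain, hence their valuations, so satisfaction transfers atom
  -- by atom.
  ⊨-oldClause : ∀ 𝒥 C → (𝒥 ⊨ oldClause C) ⇔ (reduct 𝒥 ⊨ C)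
  ⊨-oldClause 𝒥 (H ⟵ B) = mk⇔
    (λ sat v b →
      Any.map (λ {A} → coe (HoldsHead-old 𝒥 v A))
        (Anyₚ.map⁻ (sat v (Allₚ.map⁺ (All.map (λ {A} → coe (sym (Holds-old 𝒥 v A))) b)))))
    (λ sat v b →
      Anyₚ.map⁺ (Any.map (λ {A} → coe (sym (HoldsHead-old 𝒥 v A)))
        (sat v (All.map (λ {A} → coe (Holds-old 𝒥 v A)) (Allₚ.map⁻ b)))))

  Holds-neg : ∀ ℐ v A → Holds (expand ℐ) v (negᵃ A) ≡ (¬ Holds ℐ v A)
  Holds-neg ℐ v (conc B s) =
    cong (λ d → ¬ concᴵ ℐ B d) (term⁺-reduct (expand ℐ) v s)
  Holds-neg ℐ v (role R s t) =
    cong₂ (λ d e → ¬ roleᴵ ℐ R d e)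
      (term⁺-reduct (expand ℐ) v s) (term⁺-reduct (expand ℐ) v t)

  expand⊨roleClash : ∀ ℐ R → expand ℐ ⊨ roleClash R
  expand⊨roleClash ℐ R v (r ∷ ¬r ∷ []) = contradiction r ¬r

  expand⊨conceptClash : ∀ ℐ D → expand ℐ ⊨ conceptClash D
  expand⊨conceptClash ℐ D v (d ∷ ¬d ∷ []) = contradiction d ¬d

  plainAtoms⁺ : ∀ {A} {H : List (HeadAtom 𝒮)} → plain A ∈ H → A ∈ plainAtoms H
  plainAtoms⁺ (here refl)                  = here refl
  plainAtoms⁺ {H = plain _ ∷ _}    (there p) = there (plainAtoms⁺ p)
  plainAtoms⁺ {H = some _ _ _ ∷ _} (there p) = plainAtoms⁺ p

  module _ (em : ExcludedMiddle 0ℓ) (dec : DecSignature 𝒮) (S : SymbolSet 𝒮) where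

    -- If the new head fails, every atom of `B` holds, so `C` yields a true atom of `H`. If that
    -- atom stayed in the head, the new head holds after all; if it was moved, its negation is among
    -- the new body atoms.
    expand⊨contrapose : ∀ ℐ C → ℐ ⊨ C → expand ℐ ⊨ contrapose dec S C
    expand⊨contrapose ℐ (H ⟵ B) sat v b = decidable-stable em refute
      where
      -- The left operands of the two appends in `contrapose`, which the append lemmas take
      -- explicitly.
      keptHead = map oldᴴ (filter (λ A → ¬? (_∈ˢ?_ dec (σᴴ A) S)) H)
      keptBody = map oldᵃ (filter (λ A → ¬? (_∈ˢ?_ dec (σ A) S)) B)

      refute : ¬ ¬ Any (HoldsHead (expand ℐ) v) (head (contrapose dec S (H ⟵ B)))
      refute headFails with find (sat v (All.tabulate bodyHolds))
        where
        bodyHolds : ∀ {A} → A ∈ B → Holds ℐ v A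
        bodyHolds {A} A∈B with _∈ˢ?_ dec (σ A) S
        ... | no A∉S = coe (Holds-old (expand ℐ) v A)
          (All.lookup (Allₚ.++⁻ˡ keptBody b)
            (∈-map⁺ oldᵃ (∈-filter⁺ (λ A → ¬? (_∈ˢ?_ dec (σ A) S)) A∈B A∉S)))
        -- Were the moved atom false, its `Neg` copy would be a true disjunct of the new head.
        ... | yes A∈S = decidable-stable em λ ¬A → headFails
          (Anyₚ.++⁺ʳ keptHead
            (lose (∈-map⁺ (plain ∘ negᵃ) (∈-filter⁺ (λ A → _∈ˢ?_ dec (σ A) S) A∈B A∈S))
              (coe (sym (Holds-neg ℐ v A)) ¬A)))
      ... | A , A∈H , hA with _∈ˢ?_ dec (σᴴ A) S
      ...   | no A∉S = headFails
        (Anyₚ.++⁺ˡ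
          (lose (∈-map⁺ oldᴴ (∈-filter⁺ (λ A → ¬? (_∈ˢ?_ dec (σᴴ A) S)) A∈H A∉S))
            (coe (sym (HoldsHead-old (expand ℐ) v A)) hA)))
      -- The case `some` is absent: its symbol lies in no `S`, so `A∈S` would inhabit the empty
      -- type.
      refute headFails | plain A , A∈H , hA | yes A∈S =
        coe (Holds-neg ℐ v A)
          (All.lookup (Allₚ.++⁻ʳ keptBody b)
            (∈-map⁺ negᵃ (∈-filter⁺ (λ A → _∈ˢ?_ dec (σ A) S) (plainAtoms⁺ A∈H) A∈S)))
          hA

    expand⊨renameClause : ∀ ℐ C → ℐ ⊨ C → All (expand ℐ ⊨_) (renameClause dec S C)
    expand⊨renameClause ℐ C sat =
      -- `reduct (expand ℐ)` is `ℐ` by eta, so `sat` already has the required type.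
      Equivalence.from (⊨-oldClause (expand ℐ) C) sat
      ∷ expand⊨contrapose ℐ C sat
      ∷ Allₚ.++⁺
          (Allₚ.map⁺ {f = roleClash}
            (All.universal (expand⊨roleClash ℐ) (filter (roleRelevant? dec C) (roles S))))
          (Allₚ.map⁺ {f = conceptClash}
            (All.universal (expand⊨conceptClash ℐ) (filter (conceptRelevant? dec C) (concepts S))))

    expand⊨𝖱 : ∀ ℐ {DL} → All (ℐ ⊨_) DL → All (expand ℐ ⊨_) (𝖱 dec S DL)
    expand⊨𝖱 ℐ sat =
      Allₚ.concat⁺ (Allₚ.map⁺ (All.map (λ {C} → expand⊨renameClause ℐ C) sat))

  -- Each block `renameClause dec S C` begins with `oldClause C`.
  reduct⊨ : ∀ dec S 𝒥 {DL} → All (𝒥 ⊨_) (𝖱 dec S DL) → All (reduct 𝒥 ⊨_) DL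
  reduct⊨ dec S 𝒥 sat = All.map
    (λ {C} renamed → Equivalence.to (⊨-oldClause 𝒥 C) (All.head renamed))
    (Allₚ.map⁻ (Allₚ.concat⁻ sat))

module _ {𝒮 : Signature} where

  expand⊨aboxFact : ∀ ℐ (A : Assertion 𝒮) → expand ℐ ⊨ aboxFact A
  expand⊨aboxFact ℐ (conc A a)   v _ = here tt
  expand⊨aboxFact ℐ (role R a b) v _ = here tt

  module _ (em : ExcludedMiddle 0ℓ) (dec : DecSignature 𝒮) where

    Ξ⇔Renamed : ∀ S t → Equisatisfiable (Ξ t) (Renamed dec S t)
    Ξ⇔Renamed S t = mk⇔
      (λ (ℐ , sat) → expand ℐ , expand⊨𝖱 em (decClausal dec) (symbols↑ S) ℐ sat)
      (λ (𝒥 , sat) → reduct 𝒥 , reduct⊨ (decClausal dec) (symbols↑ S) 𝒥 sat)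

    -- A model of `Ξ (𝒯 𝒦)` may violate `𝒜 𝒦`; the facts still hold in its expansion because they
    -- speak only of `ABox` symbols. The converse drops them.
    Ξ⇔𝖪* : ∀ 𝒦 → Equisatisfiable (Ξ (𝒯 𝒦)) (𝖪* dec 𝒦)
    Ξ⇔𝖪* 𝒦 = mk⇔
      (λ (ℐ , sat) → expand ℐ ,
        Allₚ.++⁺ (expand⊨𝖱 em (decClausal dec) S ℐ sat)
          (Allₚ.map⁺ (All.universal (expand⊨aboxFact ℐ) (𝒜 𝒦))))
      (λ (𝒥 , sat) → reduct 𝒥 ,
        reduct⊨ (decClausal dec) S 𝒥 (Allₚ.++⁻ˡ (𝖱 (decClausal dec) S (Ξ (𝒯 𝒦))) sat))
      where S = symbols↑ (symABox (𝒜 𝒦))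

proposition2 : ExcludedMiddle 0ℓ →
    (𝒮 : Signature) (dec : DecSignature 𝒮) (𝒦 : KB 𝒮) →
    let S = symABox (𝒜 𝒦) ∪ symTerminology (𝒯 𝒦)
    in Equisatisfiable (Ξ (𝒯 𝒦)) (Renamed dec S (𝒯 𝒦))
    × Equisatisfiable (Renamed dec S (𝒯 𝒦)) (𝖪* dec 𝒦)
    × Equisatisfiable (Ξ (𝒯 𝒦)) (𝖪* dec 𝒦)
proposition2 em 𝒮 dec 𝒦 =
  -- The renamed set and `𝖪*` may rename different symbols, so they are compared through `Ξ (𝒯 𝒦)`.
  Ξ⇔R , ⇔.trans (⇔.sym Ξ⇔R) (Ξ⇔𝖪* em dec 𝒦) , Ξ⇔𝖪* em dec 𝒦
  where Ξ⇔R = Ξ⇔Renamed em dec (symABox (𝒜 𝒦) ∪ symTerminology (𝒯 𝒦)) (𝒯 𝒦)
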